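{- Let $(I,\preccurlyeq)$ be a directed set, let $S(\Lambda^{\preccurlyeq})$ be a direct spectrum over $(I,\preccurlyeq)$ with sets $\lambda_0(i)$, transports $\lambda^{\preccurlyeq}_{ij}$ and Bishop spaces $\mathcal F_i=(\lambda_0(i),F_i)$, let $(J,e,\mathrm{cof}_J)$ be a cofinal subset of $I$, and let $S(\Lambda^{\preccurlyeq})\circ e$ be the relative spectrum of $S(\Lambda^{\preccurlyeq})$ to $J$, with Bishop spaces $\mathcal F_j:=\mathcal F_{e(j)}$, $j\in J$. Then $\underset{\to}{\mathrm{Lim}}\,\mathcal F_j\simeq\underset{\to}{\mathrm{Lim}}\,\mathcal F_i$, where the left side is the direct limit of $S(\Lambda^{\preccurlyeq})\circ e$ over $J$ and the right side the direct limit of $S(\Lambda^{\preccurlyeq})$ over $I$.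
   Context: Work in Bishop-style constructive mathematics (no choice principles). Each set has its own equality; functions respect it; $e$ is an embedding if $e(j)=e(j')$ implies $j=j'$. A directed set $(I,\preccurlyeq)$: a set with a reflexive transitive relation respecting equality, any two elements having a common upper bound. A direct family over $(I,\preccurlyeq)$: sets $\lambda_0(i)$ and functions $\lambda^{\preccurlyeq}_{ij}:\lambda_0(i)\to\lambda_0(j)$ for $i\preccurlyeq j$ with $\lambda^{\preccurlyeq}_{ii}=\mathrm{id}$ and $\lambda^{\preccurlyeq}_{ik}=\lambda^{\preccurlyeq}_{jk}\circ\lambda^{\preccurlyeq}_{ij}$. Bishop spaces: a Bishop topology on $X$ is a set $F$ of functions $X\to\mathbb R$ containing constants, closed under addition, under composition with functions $\mathbb R\to\mathbb R$ uniformly continuous on every $[-n,n]$, and under uniform limits; $\bigvee F_0$ = least Bishop topology containing $F_0$; a Bishop morphism $(X,F)\to(Y,G)$ is a function $h$ with $g\circ h\in F$ for all $g\in G$; a Bishop isomorphism is a bijective Bishop morphism whose inverse is a Bishop morphism; $\simeq$ means Bishop isomorphic. A direct spectrum: a direct family with Bishop topologies $F_i$ on $\lambda_0(i)$ such that each transport is a Bishop morphism. Cofinal subset $(J,e,\mathrm{cof}_J)$: a set $J$, an embedding $e:J\to I$ (with $j\preccurlyeq j'$ iff $e(j)\preccurlyeq e(j')$) and a function $\mathrm{cof}_J:I\to J$ with $\mathrm{cof}_J(e(j))=j$ for all $j$, $i\preccurlyeq i'\Rightarrow\mathrm{cof}_J(i)\preccurlyeq\mathrm{cof}_J(i')$,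 and $i\preccurlyeq e(\mathrm{cof}_J(i))$ for all $i$ (then $(J,\preccurlyeq)$ is directed). The relative spectrum $S(\Lambda^{\preccurlyeq})\circ e$ over $(J,\preccurlyeq)$ has sets $\lambda_0(e(j))$, transports $\lambda^{\preccurlyeq}_{e(j)e(j')}$ for $j\preccurlyeq j'$, and topologies $F_{e(j)}$. Direct limit of a direct spectrum over $(I,\preccurlyeq)$: $\sum^{\preccurlyeq}\lambda_0(i)$ = pairs $(i,x)$ with $(i,x)=(j,y)$ iff there is $k\succcurlyeq i,j$ with $\lambda^{\preccurlyeq}_{ik}(x)=\lambda^{\preccurlyeq}_{jk}(y)$; $\prod^{\succcurlyeq}F_i$ = dependent assignments $\Theta$ with $\Theta_i\in F_i$ and $\Theta_i=\Theta_j\circ\lambda^{\preccurlyeq}_{ij}$ for $i\preccurlyeq j$; $\underset{\to}{\mathrm{Lim}}\,\lambda_0(i)$ = equivalence classes $\mathrm{eql}_0(i,x)$ under this equality; $\mathrm{eql}_0f_\Theta(\mathrm{eql}_0(i,x)):=\Theta_i(x)$; $\underset{\to}{\mathrm{Lim}}\,\mathcal F_i=(\underset{\to}{\mathrm{Lim}}\,\lambda_0(i),\bigvee\{\mathrm{eql}_0f_\Theta:\Theta\in\prod^{\succcurlyeq}F_i\})$. -}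

module Defs where

open import Level using (Level; _⊔_; 0ℓ) renaming (suc to lsuc)
open import Data.Nat.Base as ℕ using (ℕ; suc)
import Data.Nat.Properties as ℕ
open import Data.Integer.Base as ℤ using (+_; +[1+_]; -[1+_])
import Data.Integer.Solver as ℤ-Solver
open import Data.Rational.Unnormalised.Base as ℚ
  using (ℚᵘ; mkℚᵘ; 0ℚᵘ; *≡*; *≤*; *<*)
import Data.Rational.Unnormalised.Properties as ℚ
import Data.Rational.Unnormalised.Solver as ℚ-Solver
open import Data.Product.Base using (Σ-syntax; ∃-syntax; _×_; _,_)
open import Data.Sum.Base using (inj₁; inj₂)
open import Function.Bundles using (Func; _⟶ₛ_; _⟨$⟩_; Injection; Bijection; Inverse)
import Function.Construct.Composition as Composition
open import Function.Definitions using (Injective)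
open import Function.Properties.Bijection using (Bijection⇒Inverse)
open import Relation.Binary.Bundles using (Setoid; Preorder)
open import Relation.Binary.PropositionalEquality.Core using (_≡_; refl; sym; subst; cong)
open import Relation.Unary using (Pred)

-- recip n is 1/(n+1): indices start at 0, so they are shifted by one
-- with respect to Bishop's.
recip : ℕ → ℚᵘ
recip n = mkℚᵘ (+ 1) n

double : ℕ → ℕ
double n = suc (2 ℕ.* n)

private
  ∣-∣≤ : ∀ p {r} → p ℚ.≤ r → ℚ.- p ℚ.≤ r → ℚ.∣ p ∣ ℚ.≤ r
  ∣-∣≤ p {r} p≤r -p≤r with ℚ.∣p∣≡p∨∣p∣≡-p p
  ... | inj₁ eq = subst (ℚ._≤ r) (sym eq) p≤r
  ... | inj₂ eq = subst (ℚ._≤ r) (sym eq) -p≤r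

  0≤recip+recip : ∀ m n → 0ℚᵘ ℚ.≤ recip m ℚ.+ recip n
  0≤recip+recip m n = ℚ.nonNegative⁻¹ (recip m ℚ.+ recip n)

  recip-double : ∀ n → recip (double n) ℚ.+ recip (double n) ℚ.≃ recip n
  recip-double n = *≡* (cross (+ suc (double n)) (+ suc n) (cong +_ (sym (ℕ.*-suc 2 n))))
    where
    open ℤ-Solver.+-*-Solver
    cross : ∀ d m → d ≡ + 2 ℤ.* m →
            (+ 1 ℤ.* d ℤ.+ + 1 ℤ.* d) ℤ.* m ≡ + 1 ℤ.* (d ℤ.* d)
    cross _ m refl = solve 1
      (λ m → let d = con (+ 2) :* m in
        (con (+ 1) :* d :+ con (+ 1) :* d) :* m := con (+ 1) :* (d :* d)) refl m

  ∣p-p∣≃0 : ∀ p → ℚ.∣ p ℚ.- p ∣ ℚ.≃ 0ℚᵘ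
  ∣p-p∣≃0 p = ℚ.∣-∣-cong (ℚ.+-inverseʳ p)

  ∣p-q∣≃∣q-p∣ : ∀ p q → ℚ.∣ p ℚ.- q ∣ ℚ.≃ ℚ.∣ q ℚ.- p ∣
  ∣p-q∣≃∣q-p∣ p q = ℚ.≃-trans (ℚ.≃-sym (ℚ.∣-p∣≃∣p∣ (p ℚ.- q)))
    (ℚ.∣-∣-cong (solve 2 (λ p q → :- (p :- q) := q :- p) ℚ.≃-refl p q))
    where open ℚ-Solver.+-*-Solver

  triangle : ∀ p q r → ℚ.∣ p ℚ.- r ∣ ℚ.≤ ℚ.∣ p ℚ.- q ∣ ℚ.+ ℚ.∣ q ℚ.- r ∣
  triangle p q r = ℚ.≤-respˡ-≃
    (ℚ.∣-∣-cong (solve 3 (λ p q r → (p :- q) :+ (q :- r) := p :- r) ℚ.≃-refl p q r))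
    (ℚ.∣p+q∣≤∣p∣+∣q∣ (p ℚ.- q) (q ℚ.- r))
    where open ℚ-Solver.+-*-Solver

  ∣p∣-∣q∣≤∣p-q∣ : ∀ p q → ℚ.∣ p ∣ ℚ.- ℚ.∣ q ∣ ℚ.≤ ℚ.∣ p ℚ.- q ∣
  ∣p∣-∣q∣≤∣p-q∣ p q = begin
    ℚ.∣ p ∣ ℚ.- ℚ.∣ q ∣
      ≃⟨ ℚ.+-congˡ (ℚ.- ℚ.∣ q ∣) (ℚ.∣-∣-cong (solve 2 (λ p q → p := (p :- q) :+ q) ℚ.≃-refl p q)) ⟩
    ℚ.∣ p ℚ.- q ℚ.+ q ∣ ℚ.- ℚ.∣ q ∣
      ≤⟨ ℚ.+-monoˡ-≤ (ℚ.- ℚ.∣ q ∣) (ℚ.∣p+q∣≤∣p∣+∣q∣ (p ℚ.- q) q) ⟩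
    ℚ.∣ p ℚ.- q ∣ ℚ.+ ℚ.∣ q ∣ ℚ.- ℚ.∣ q ∣
      ≃⟨ solve 2 (λ a b → (a :+ b) :- b := a) ℚ.≃-refl ℚ.∣ p ℚ.- q ∣ ℚ.∣ q ∣ ⟩
    ℚ.∣ p ℚ.- q ∣ ∎
    where
    open ℚ.≤-Reasoning
    open ℚ-Solver.+-*-Solver

  ∣∣p∣-∣q∣∣≤∣p-q∣ : ∀ p q → ℚ.∣ ℚ.∣ p ∣ ℚ.- ℚ.∣ q ∣ ∣ ℚ.≤ ℚ.∣ p ℚ.- q ∣
  ∣∣p∣-∣q∣∣≤∣p-q∣ p q = ∣-∣≤ (ℚ.∣ p ∣ ℚ.- ℚ.∣ q ∣) (∣p∣-∣q∣≤∣p-q∣ p q)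
    (ℚ.≤-respˡ-≃ (solve 2 (λ a b → b :- a := :- (a :- b)) ℚ.≃-refl ℚ.∣ p ∣ ℚ.∣ q ∣)
      (ℚ.≤-respʳ-≃ (∣p-q∣≃∣q-p∣ q p) (∣p∣-∣q∣≤∣p-q∣ q p)))
    where open ℚ-Solver.+-*-Solver

  ∣p+q-[r+s]∣≤ : ∀ p q r s →
    ℚ.∣ (p ℚ.+ q) ℚ.- (r ℚ.+ s) ∣ ℚ.≤ ℚ.∣ p ℚ.- r ∣ ℚ.+ ℚ.∣ q ℚ.- s ∣
  ∣p+q-[r+s]∣≤ p q r s = ℚ.≤-respˡ-≃
    (ℚ.∣-∣-cong (solve 4 (λ p q r s → (p :- r) :+ (q :- s) := (p :+ q) :- (r :+ s)) ℚ.≃-refl p q r s))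
    (ℚ.∣p+q∣≤∣p∣+∣q∣ (p ℚ.- r) (q ℚ.- s))
    where open ℚ-Solver.+-*-Solver

  archimedean : ∀ r → 0ℚᵘ ℚ.< r → ∃[ m ] mkℚᵘ (+ 6) m ℚ.< r
  archimedean (mkℚᵘ +[1+ a ] d) _ = 6 ℕ.* suc d , *<* (ℤ.+<+ (ℕ.<-≤-trans
    (ℕ.n<1+n (6 ℕ.* suc d)) (ℕ.m≤m+n (suc (6 ℕ.* suc d)) (a ℕ.* suc (6 ℕ.* suc d)))))
  archimedean (mkℚᵘ (+ 0) d) (*<* (ℤ.+<+ ()))
  archimedean (mkℚᵘ -[1+ a ] d) (*<* ())

  ≤-limit : ∀ p q → (∀ m → p ℚ.≤ q ℚ.+ mkℚᵘ (+ 6) m) → p ℚ.≤ q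
  ≤-limit p q h = ℚ.≮⇒≥ λ q<p →
    let m , 6/m<p-q = archimedean (p ℚ.- q)
          (ℚ.<-respˡ-≃ (ℚ.+-inverseʳ q) (ℚ.+-monoˡ-< (ℚ.- q) q<p))
    in ℚ.<⇒≱ (ℚ.<-respʳ-≃ (solve 2 (λ p q → q :+ (p :- q) := p) ℚ.≃-refl p q)
                (ℚ.+-monoʳ-< q 6/m<p-q)) (h m)
    where open ℚ-Solver.+-*-Solver

-- Bishop's real numbers: regular sequences of rationals.
record ℝ : Set where
  field
    seq     : ℕ → ℚᵘ
    regular : ∀ m n → ℚ.∣ seq m ℚ.- seq n ∣ ℚ.≤ recip m ℚ.+ recip n

open ℝ public

infix  4 _≈ᵣ_ _≤ᵣ_ _<ᵣ_
infixl 6 _+ᵣ_ _-ᵣ_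
infix  8 -ᵣ_

_≈ᵣ_ : ℝ → ℝ → Set
x ≈ᵣ y = ∀ n → ℚ.∣ seq x n ℚ.- seq y n ∣ ℚ.≤ recip n ℚ.+ recip n

private
  ≈ᵣ-refl : ∀ {x} → x ≈ᵣ x
  ≈ᵣ-refl {x} n = regular x n n

  ≈ᵣ-sym : ∀ {x y} → x ≈ᵣ y → y ≈ᵣ x
  ≈ᵣ-sym {x} {y} h n = ℚ.≤-respˡ-≃ (∣p-q∣≃∣q-p∣ (seq x n) (seq y n)) (h n)

  six-terms : ∀ n m →
    (recip n ℚ.+ recip m) ℚ.+ ((recip m ℚ.+ recip m) ℚ.+ ((recip m ℚ.+ recip m) ℚ.+ (recip m ℚ.+ recip n)))
      ℚ.≃ recip n ℚ.+ recip n ℚ.+ mkℚᵘ (+ 6) m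
  six-terms n m = ℚ.≃-trans
    (solve 2 (λ n m → (n :+ m) :+ ((m :+ m) :+ ((m :+ m) :+ (m :+ n)))
                    := n :+ n :+ con (mkℚᵘ (+ 6) 0) :* m) ℚ.≃-refl (recip n) (recip m))
    (ℚ.+-congʳ (recip n ℚ.+ recip n)
      (ℚ.≃-reflexive (cong (mkℚᵘ (+ 6)) (ℕ.+-identityʳ m))))
    where open ℚ-Solver.+-*-Solver

  ≈ᵣ-trans : ∀ {x y z} → x ≈ᵣ y → y ≈ᵣ z → x ≈ᵣ z
  ≈ᵣ-trans {x} {y} {z} h k n = ≤-limit _ _ λ m → begin
    ℚ.∣ seq x n ℚ.- seq z n ∣
      ≤⟨ triangle (seq x n) (seq x m) (seq z n) ⟩
    ℚ.∣ seq x n ℚ.- seq x m ∣ ℚ.+ ℚ.∣ seq x m ℚ.- seq z n ∣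
      ≤⟨ ℚ.+-mono-≤ (regular x n m)
          (ℚ.≤-trans (triangle (seq x m) (seq y m) (seq z n))
            (ℚ.+-mono-≤ (h m)
              (ℚ.≤-trans (triangle (seq y m) (seq z m) (seq z n))
                (ℚ.+-mono-≤ (k m) (regular z m n))))) ⟩
    (recip n ℚ.+ recip m) ℚ.+ ((recip m ℚ.+ recip m) ℚ.+ ((recip m ℚ.+ recip m) ℚ.+ (recip m ℚ.+ recip n)))
      ≃⟨ six-terms n m ⟩
    recip n ℚ.+ recip n ℚ.+ mkℚᵘ (+ 6) m ∎
    where open ℚ.≤-Reasoning

ℝ-setoid : Setoid 0ℓ 0ℓ
ℝ-setoid = record
  { Carrier       = ℝ
  ; _≈_           = _≈ᵣ_
  ; isEquivalence = record
    { refl  = λ {x} → ≈ᵣ-refl {x}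
    ; sym   = λ {x y} → ≈ᵣ-sym {x} {y}
    ; trans = λ {x y z} → ≈ᵣ-trans {x} {y} {z}
    }
  }

fromℚ : ℚᵘ → ℝ
fromℚ q = record
  { seq     = λ _ → q
  ; regular = λ m n → ℚ.≤-respˡ-≃ (ℚ.≃-sym (∣p-p∣≃0 q)) (0≤recip+recip m n)
  }

fromℕ : ℕ → ℝ
fromℕ n = fromℚ (mkℚᵘ (+ n) 0)

0ᵣ : ℝ
0ᵣ = fromℚ 0ℚᵘ

private
  shuffle : ∀ m n →
    (recip (double m) ℚ.+ recip (double n)) ℚ.+ (recip (double m) ℚ.+ recip (double n))
      ℚ.≃ recip m ℚ.+ recip n
  shuffle m n = ℚ.≃-trans
    (solve 2 (λ a b → (a :+ b) :+ (a :+ b) := (a :+ a) :+ (b :+ b)) ℚ.≃-refl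
      (recip (double m)) (recip (double n)))
    (ℚ.+-cong (recip-double m) (recip-double n))
    where open ℚ-Solver.+-*-Solver

_+ᵣ_ : ℝ → ℝ → ℝ
x +ᵣ y = record
  { seq     = λ n → seq x (double n) ℚ.+ seq y (double n)
  ; regular = λ m n → ℚ.≤-trans
      (∣p+q-[r+s]∣≤ (seq x (double m)) (seq y (double m)) (seq x (double n)) (seq y (double n)))
      (ℚ.≤-respʳ-≃ (shuffle m n)
        (ℚ.+-mono-≤ (regular x (double m) (double n)) (regular y (double m) (double n))))
  }

+ᵣ-cong : ∀ {x x′ y y′} → x ≈ᵣ x′ → y ≈ᵣ y′ → x +ᵣ y ≈ᵣ x′ +ᵣ y′
+ᵣ-cong {x} {x′} {y} {y′} h k n = ℚ.≤-trans
  (∣p+q-[r+s]∣≤ (seq x (double n)) (seq y (double n)) (seq x′ (double n)) (seq y′ (double n)))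
  (ℚ.≤-respʳ-≃ (shuffle n n) (ℚ.+-mono-≤ (h (double n)) (k (double n))))

-ᵣ_ : ℝ → ℝ
-ᵣ x = record
  { seq     = λ n → ℚ.- seq x n
  ; regular = λ m n → ℚ.≤-respˡ-≃
      (ℚ.≃-trans (ℚ.≃-sym (ℚ.∣-p∣≃∣p∣ (seq x m ℚ.- seq x n)))
        (ℚ.∣-∣-cong (solve 2 (λ p q → :- (p :- q) := :- p :- (:- q)) ℚ.≃-refl (seq x m) (seq x n))))
      (regular x m n)
  }
  where open ℚ-Solver.+-*-Solver

_-ᵣ_ : ℝ → ℝ → ℝ
x -ᵣ y = x +ᵣ (-ᵣ y)

∣_∣ᵣ : ℝ → ℝ
∣ x ∣ᵣ = record
  { seq     = λ n → ℚ.∣ seq x n ∣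
  ; regular = λ m n → ℚ.≤-trans (∣∣p∣-∣q∣∣≤∣p-q∣ (seq x m) (seq x n)) (regular x m n)
  }

_≤ᵣ_ : ℝ → ℝ → Set
x ≤ᵣ y = ∀ n → ℚ.- recip n ℚ.≤ seq (y -ᵣ x) n

_<ᵣ_ : ℝ → ℝ → Set
x <ᵣ y = ∃[ n ] recip n ℚ.< seq (y -ᵣ x) n

private
  variable
    a b c d ℓ ℓ₁ ℓ₂ ℓ₃ f g : Level

infixr 9 _∘ₛ_
infix  4 _≗ₛ_
infixl 6 _+ₛ_

_∘ₛ_ : {X : Setoid a ℓ₁} {Y : Setoid b ℓ₂} {Z : Setoid c ℓ₃} →
       Y ⟶ₛ Z → X ⟶ₛ Y → X ⟶ₛ Z
h ∘ₛ k = Composition.function k h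

_≗ₛ_ : {X : Setoid a ℓ₁} {Y : Setoid b ℓ₂} → X ⟶ₛ Y → X ⟶ₛ Y → Set (a ⊔ ℓ₂)
_≗ₛ_ {Y = Y} h k = ∀ x → Setoid._≈_ Y (h ⟨$⟩ x) (k ⟨$⟩ x)

constₛ : (X : Setoid a ℓ) → ℝ → X ⟶ₛ ℝ-setoid
constₛ X r = record { to = λ _ → r ; cong = λ _ → Setoid.refl ℝ-setoid {r} }

_+ₛ_ : {X : Setoid a ℓ} → X ⟶ₛ ℝ-setoid → X ⟶ₛ ℝ-setoid → X ⟶ₛ ℝ-setoid
h +ₛ k = record
  { to   = λ x → (h ⟨$⟩ x) +ᵣ (k ⟨$⟩ x)
  ; cong = λ {x} {y} x≈y →
      +ᵣ-cong {h ⟨$⟩ x} {h ⟨$⟩ y} {k ⟨$⟩ x} {k ⟨$⟩ y} (Func.cong h x≈y) (Func.cong k x≈y)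
  }

_∈[-_,+] : ℝ → ℕ → Set
x ∈[- n ,+] = (-ᵣ fromℕ n ≤ᵣ x) × (x ≤ᵣ fromℕ n)

UniformlyContinuousOnIntervals : ℝ-setoid ⟶ₛ ℝ-setoid → Set
UniformlyContinuousOnIntervals φ =
  ∀ (n : ℕ) (ε : ℝ) → 0ᵣ <ᵣ ε →
  Σ[ δ ∈ ℝ ] (0ᵣ <ᵣ δ ×
    (∀ x y → x ∈[- n ,+] → y ∈[- n ,+] →
      ∣ x -ᵣ y ∣ᵣ ≤ᵣ δ → ∣ (φ ⟨$⟩ x) -ᵣ (φ ⟨$⟩ y) ∣ᵣ ≤ᵣ ε))

UniformlyWithin : {X : Setoid a ℓ} → ℝ → X ⟶ₛ ℝ-setoid → X ⟶ₛ ℝ-setoid → Set a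
UniformlyWithin ε h k = ∀ x → ∣ (h ⟨$⟩ x) -ᵣ (k ⟨$⟩ x) ∣ᵣ ≤ᵣ ε

-- A subset of the set of functions X → ℝ is a predicate respecting the
-- pointwise equality of functions, hence the first field.
record IsBishopTopology {X : Setoid a ℓ} (F : Pred (X ⟶ₛ ℝ-setoid) f) : Set (a ⊔ ℓ ⊔ f) where
  field
    respects      : ∀ {h k} → h ≗ₛ k → F h → F k
    constant      : ∀ r → F (constₛ X r)
    addition      : ∀ {h k} → F h → F k → F (h +ₛ k)
    composition   : ∀ φ {h} → UniformlyContinuousOnIntervals φ → F h → F (φ ∘ₛ h)
    uniform-limit : ∀ {h} → (∀ ε → 0ᵣ <ᵣ ε → ∃[ k ] (F k × UniformlyWithin ε k h)) → F h

record BishopTopology (X : Setoid a ℓ) f : Set (a ⊔ ℓ ⊔ lsuc f) where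
  field
    member           : Pred (X ⟶ₛ ℝ-setoid) f
    isBishopTopology : IsBishopTopology member

  open IsBishopTopology isBishopTopology public

record BishopSpace a ℓ f : Set (lsuc (a ⊔ ℓ ⊔ f)) where
  field
    set      : Setoid a ℓ
    topology : BishopTopology set f

  open BishopTopology topology public

-- The least Bishop topology containing F₀, generated inductively.
data ⋁ {X : Setoid a ℓ} (F₀ : Pred (X ⟶ₛ ℝ-setoid) f) : Pred (X ⟶ₛ ℝ-setoid) (a ⊔ ℓ ⊔ f) where
  base          : ∀ {h} → F₀ h → ⋁ F₀ h
  respects      : ∀ {h k} → h ≗ₛ k → ⋁ F₀ h → ⋁ F₀ k
  constant      : ∀ r → ⋁ F₀ (constₛ X r)
  addition      : ∀ {h k} → ⋁ F₀ h → ⋁ F₀ k → ⋁ F₀ (h +ₛ k)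
  composition   : ∀ φ {h} → UniformlyContinuousOnIntervals φ → ⋁ F₀ h → ⋁ F₀ (φ ∘ₛ h)
  uniform-limit : ∀ {h} → (∀ ε → 0ᵣ <ᵣ ε → ∃[ k ] (⋁ F₀ k × UniformlyWithin ε k h)) → ⋁ F₀ h

⋁-topology : {X : Setoid a ℓ} → Pred (X ⟶ₛ ℝ-setoid) f → BishopTopology X (a ⊔ ℓ ⊔ f)
⋁-topology F₀ = record
  { member           = ⋁ F₀
  ; isBishopTopology = record
    { respects      = respects
    ; constant      = constant
    ; addition      = addition
    ; composition   = composition
    ; uniform-limit = uniform-limit
    }
  }

⋁-least : {X : Setoid a ℓ} {F₀ : Pred (X ⟶ₛ ℝ-setoid) f} {G : Pred (X ⟶ₛ ℝ-setoid) g} →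
          IsBishopTopology G → (∀ {h} → F₀ h → G h) → ∀ {h} → ⋁ F₀ h → G h
⋁-least T F₀⊆G (base p)              = F₀⊆G p
⋁-least T F₀⊆G (respects h≗k p)      = IsBishopTopology.respects T h≗k (⋁-least T F₀⊆G p)
⋁-least T F₀⊆G (constant r)          = IsBishopTopology.constant T r
⋁-least T F₀⊆G (addition p q)        = IsBishopTopology.addition T (⋁-least T F₀⊆G p) (⋁-least T F₀⊆G q)
⋁-least T F₀⊆G (composition φ uc p)  = IsBishopTopology.composition T φ uc (⋁-least T F₀⊆G p)
⋁-least T F₀⊆G (uniform-limit approx) = IsBishopTopology.uniform-limit T λ ε 0<ε →
  let k , p , close = approx ε 0<ε in k , ⋁-least T F₀⊆G p , close

IsBishopMorphism : {X : Setoid a ℓ₁} {Y : Setoid b ℓ₂} →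
                   BishopTopology X f → BishopTopology Y g → X ⟶ₛ Y → Set (b ⊔ ℓ₂ ⊔ f ⊔ g)
IsBishopMorphism F G h = ∀ k → BishopTopology.member G k → BishopTopology.member F (k ∘ₛ h)

inverse : {X : Setoid a ℓ₁} {Y : Setoid b ℓ₂} → Bijection X Y → Y ⟶ₛ X
inverse bij = record { to = Inverse.from inv ; cong = Inverse.from-cong inv }
  where inv = Bijection⇒Inverse bij

infix 4 _≃_

record _≃_ (X : BishopSpace a ℓ₁ f) (Y : BishopSpace b ℓ₂ g) : Set (a ⊔ ℓ₁ ⊔ f ⊔ b ⊔ ℓ₂ ⊔ g) where
  private
    module X = BishopSpace X
    module Y = BishopSpace Y
  field
    bijection        : Bijection X.set Y.set
    morphism         : IsBishopMorphism X.topology Y.topology (Injection.function (Bijection.injection bijection))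
    inverse-morphism : IsBishopMorphism Y.topology X.topology (inverse bijection)

record DirectedSet a ℓ₁ ℓ₂ : Set (lsuc (a ⊔ ℓ₁ ⊔ ℓ₂)) where
  field
    preorder    : Preorder a ℓ₁ ℓ₂

  open Preorder preorder public renaming (_≲_ to _≼_; refl to ≼-refl; trans to ≼-trans)

  field
    upper-bound : ∀ i j → ∃[ k ] (i ≼ k × j ≼ k)

  set : Setoid a ℓ₁
  set = Eq.setoid

record CofinalSubset (I : DirectedSet a ℓ₁ ℓ₂) b ℓ : Set (lsuc (b ⊔ ℓ) ⊔ a ⊔ ℓ₁ ⊔ ℓ₂) where
  private module I = DirectedSet I
  field
    J           : Setoid b ℓ
    e           : J ⟶ₛ I.set
    e-embedding : Injective (Setoid._≈_ J) I._≈_ (e ⟨$⟩_)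

  _≼ᴶ_ : Setoid.Carrier J → Setoid.Carrier J → Set ℓ₂
  j ≼ᴶ j′ = (e ⟨$⟩ j) I.≼ (e ⟨$⟩ j′)

  field
    cof         : I.set ⟶ₛ J
    cof-e       : ∀ j → Setoid._≈_ J (cof ⟨$⟩ (e ⟨$⟩ j)) j
    cof-mono    : ∀ {i i′} → i I.≼ i′ → (cof ⟨$⟩ i) ≼ᴶ (cof ⟨$⟩ i′)
    cof-upper   : ∀ i → i I.≼ (e ⟨$⟩ (cof ⟨$⟩ i))

  directedSet : DirectedSet b ℓ ℓ₂
  directedSet = record
    { preorder    = record
      { Carrier    = Setoid.Carrier J
      ; _≈_        = Setoid._≈_ J
      ; _≲_        = _≼ᴶ_
      ; isPreorder = record
        { isEquivalence = Setoid.isEquivalence J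
        ; reflexive     = λ j≈j′ → I.reflexive (Func.cong e j≈j′)
        ; trans         = I.≼-trans
        }
      }
    ; upper-bound = λ j j′ →
        let k , j≼k , j′≼k = I.upper-bound (e ⟨$⟩ j) (e ⟨$⟩ j′)
        in cof ⟨$⟩ k , I.≼-trans j≼k (cof-upper k) , I.≼-trans j′≼k (cof-upper k)
    }

-- The laws quantify over all proofs of i ≼ j, so together they make the
-- transports independent of these proofs.  Equal indices have isomorphic
-- sets because i ≈ j implies i ≼ j and j ≼ i.
record DirectFamily (I : DirectedSet a ℓ₁ ℓ₂) c ℓ : Set (a ⊔ ℓ₂ ⊔ lsuc (c ⊔ ℓ)) where
  open DirectedSet I using (Carrier; _≼_)
  field
    λ₀           : Carrier → Setoid c ℓ
    transport    : ∀ {i j} → i ≼ j → λ₀ i ⟶ₛ λ₀ j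
    transport-id : ∀ {i} (p : i ≼ i) x → Setoid._≈_ (λ₀ i) (transport p ⟨$⟩ x) x
    transport-∘  : ∀ {i j k} (p : i ≼ j) (q : j ≼ k) (r : i ≼ k) →
                   transport r ≗ₛ transport q ∘ₛ transport p

record DirectSpectrum (I : DirectedSet a ℓ₁ ℓ₂) c ℓ f : Set (a ⊔ ℓ₂ ⊔ lsuc (c ⊔ ℓ ⊔ f)) where
  open DirectedSet I using (Carrier; _≼_)
  field
    family : DirectFamily I c ℓ

  open DirectFamily family public

  field
    F                  : ∀ i → BishopTopology (λ₀ i) f
    transport-morphism : ∀ {i j} (p : i ≼ j) → IsBishopMorphism (F i) (F j) (transport p)

relativeSpectrum : {I : DirectedSet a ℓ₁ ℓ₂} → DirectSpectrum I c ℓ f →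
                   (C : CofinalSubset I b ℓ₃) → DirectSpectrum (CofinalSubset.directedSet C) c ℓ f
relativeSpectrum S C = record
  { family             = record
    { λ₀           = λ j → S.λ₀ (e ⟨$⟩ j)
    ; transport    = S.transport
    ; transport-id = S.transport-id
    ; transport-∘  = S.transport-∘
    }
  ; F                  = λ j → S.F (e ⟨$⟩ j)
  ; transport-morphism = S.transport-morphism
  }
  where
  module S = DirectSpectrum S
  open CofinalSubset C using (e)

module _ {I : DirectedSet a ℓ₁ ℓ₂} (S : DirectSpectrum I c ℓ f) where
  private
    module I = DirectedSet I
    module S = DirectSpectrum S
    module λ₀ i = Setoid (S.λ₀ i)

  _≈-lim_ : (Σ[ i ∈ I.Carrier ] λ₀.Carrier i) → (Σ[ i ∈ I.Carrier ] λ₀.Carrier i) → Set (a ⊔ ℓ₂ ⊔ ℓ)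
  (i , x) ≈-lim (j , y) = ∃[ k ] Σ[ p ∈ i I.≼ k ] Σ[ q ∈ j I.≼ k ]
    λ₀._≈_ k (S.transport p ⟨$⟩ x) (S.transport q ⟨$⟩ y)

  private
    ≈-lim-trans : ∀ {s t u} → s ≈-lim t → t ≈-lim u → s ≈-lim u
    ≈-lim-trans {i , x} {j , y} {l , z} (k , p , q , eq) (k′ , p′ , q′ , eq′) =
      let n , r , r′ = I.upper-bound k k′
          open λ₀ n using () renaming (trans to infixr 5 _∙_; sym to _⁻¹)
      in n , I.≼-trans p r , I.≼-trans q′ r′ ,
         (S.transport-∘ p r _ x ∙ Func.cong (S.transport r) eq
           ∙ S.transport-∘ q r (I.≼-trans q r) y ⁻¹
           ∙ S.transport-∘ p′ r′ (I.≼-trans q r) y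
           ∙ Func.cong (S.transport r′) eq′ ∙ S.transport-∘ q′ r′ _ z ⁻¹)

  -- The set of equivalence classes eql₀ (i , x) is the set of pairs
  -- (i , x) equipped with the equivalence as its equality.
  Lim-set : Setoid (a ⊔ c) (a ⊔ ℓ₂ ⊔ ℓ)
  Lim-set = record
    { Carrier       = Σ[ i ∈ I.Carrier ] λ₀.Carrier i
    ; _≈_           = _≈-lim_
    ; isEquivalence = record
      { refl  = λ {(i , x)} → i , I.≼-refl , I.≼-refl , λ₀.refl i
      ; sym   = λ (k , p , q , eq) → k , q , p , λ₀.sym k eq
      ; trans = ≈-lim-trans
      }
    }

  -- The elements of ∏^≽ F_i.
  record CompatibleFunctions : Set (a ⊔ ℓ₂ ⊔ c ⊔ ℓ ⊔ f) where
    field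
      Θ          : ∀ i → S.λ₀ i ⟶ₛ ℝ-setoid
      Θ∈F        : ∀ i → BishopTopology.member (S.F i) (Θ i)
      compatible : ∀ {i j} (p : i I.≼ j) → Θ i ≗ₛ Θ j ∘ₛ S.transport p

  eql₀f : CompatibleFunctions → Lim-set ⟶ₛ ℝ-setoid
  eql₀f T = record
    { to   = λ (i , x) → Θ i ⟨$⟩ x
    ; cong = λ {(i , x)} {(j , y)} (k , p , q , eq) →
        ≈ᵣ.trans {Θ i ⟨$⟩ x} {Θ k ⟨$⟩ (S.transport p ⟨$⟩ x)} {Θ j ⟨$⟩ y}
          (compatible p x)
          (≈ᵣ.trans {Θ k ⟨$⟩ (S.transport p ⟨$⟩ x)} {Θ k ⟨$⟩ (S.transport q ⟨$⟩ y)} {Θ j ⟨$⟩ y}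
            (Func.cong (Θ k) eq)
            (≈ᵣ.sym {Θ j ⟨$⟩ y} {Θ k ⟨$⟩ (S.transport q ⟨$⟩ y)} (compatible q y)))
    }
    where
    open CompatibleFunctions T
    module ≈ᵣ = Setoid ℝ-setoid

  Lim : BishopSpace (a ⊔ c) (a ⊔ ℓ₂ ⊔ ℓ) (a ⊔ ℓ₂ ⊔ c ⊔ ℓ ⊔ f)
  Lim = record
    { set      = Lim-set
    ; topology = ⋁-topology λ h → Σ[ T ∈ CompatibleFunctions ] h ≗ₛ eql₀f T
    }

{-# OPTIONS --safe #-}
-- The inclusion (j , x) ↦ (e j , x) of the limit over J into the limit over I
-- has the inverse (i , x) ↦ (cof i , λ_{i, e (cof i)} x).  Both maps carry
-- generators eql₀f Θ to generators: a compatible family over I restricts along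
-- e, and a compatible family Θ over J extends to I by
-- i ↦ Θ_{cof i} ∘ λ_{i, e (cof i)}, where monotonicity of cof gives
-- compatibility.
module Submission where

open import Defs
open import Level using (Level)
open import Data.Product.Base using (_,_)
open import Function.Bundles using (Func; _⟶ₛ_; _⟨$⟩_; Bijection)
open import Function.Definitions using (Injective; Surjective)
open import Relation.Binary.Bundles using (Setoid)
import Relation.Binary.Reasoning.Setoid as SetoidReasoning
open import Relation.Unary using (Pred)

private
  variable
    a b c f g ℓ ℓ₁ ℓ₂ ℓ₃ : Level

-- The functions `k` with `k ∘ₛ h` in `G` form a Bishop topology, so by leastness they include all
-- of `⋁ F₀` once they include the generators.
⋁-morphism : {X : Setoid a ℓ₁} {Y : Setoid b ℓ₂} (G : BishopTopology X g)
             {F₀ : Pred (Y ⟶ₛ ℝ-setoid) f} (h : X ⟶ₛ Y) →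
             (∀ k → F₀ k → BishopTopology.member G (k ∘ₛ h)) →
             IsBishopMorphism G (⋁-topology F₀) h
⋁-morphism G h F₀∘h⊆G k = ⋁-least
  {G = λ k → G.member (k ∘ₛ h)}
  (record
    { respects      = λ k≗k′ → G.respects (λ x → k≗k′ (h ⟨$⟩ x))
    ; constant      = G.constant
    ; addition      = G.addition
    ; composition   = λ φ → G.composition φ
    ; uniform-limit = λ approx → G.uniform-limit λ ε 0<ε →
        let k , k∈G , close = approx ε 0<ε
        in k ∘ₛ h , k∈G , λ x → close (h ⟨$⟩ x)
    })
  (λ {k} → F₀∘h⊆G k)
  where module G = BishopTopology G

module _ {I : DirectedSet a ℓ₁ ℓ₂} (S : DirectSpectrum I c ℓ f) (C : CofinalSubset I b ℓ₃) where
  private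
    module I = DirectedSet I
    module S = DirectSpectrum S
    open CofinalSubset C

    SJ : DirectSpectrum directedSet c ℓ f
    SJ = relativeSpectrum S C

    module LimI = Setoid (Lim-set S)
    module LimJ = Setoid (Lim-set SJ)

  Lim-inclusion : Lim-set SJ ⟶ₛ Lim-set S
  Lim-inclusion = record
    { to   = λ (j , x) → e ⟨$⟩ j , x
    ; cong = λ (k , p , q , eq) → e ⟨$⟩ k , p , q , eq
    }

  -- The bound `k` witnessing equality over `I` need not be in the image of `e`; transporting
  -- further to `e (cof k)` gives a bound indexed by `J`.
  Lim-inclusion-injective : Injective LimJ._≈_ LimI._≈_ (Lim-inclusion ⟨$⟩_)
  Lim-inclusion-injective {_ , x} {_ , y} (k , p , q , eq) =
    let k≼ = cof-upper k in
    cof ⟨$⟩ k , I.≼-trans p k≼ , I.≼-trans q k≼ , (begin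
      S.transport (I.≼-trans p k≼) ⟨$⟩ x        ≈⟨ S.transport-∘ p k≼ _ x ⟩
      S.transport k≼ ⟨$⟩ (S.transport p ⟨$⟩ x)  ≈⟨ Func.cong (S.transport k≼) eq ⟩
      S.transport k≼ ⟨$⟩ (S.transport q ⟨$⟩ y)  ≈⟨ S.transport-∘ q k≼ _ y ⟨
      S.transport (I.≼-trans q k≼) ⟨$⟩ y        ∎)
    where open SetoidReasoning (S.λ₀ (e ⟨$⟩ (cof ⟨$⟩ k)))

  transport-≈-lim : ∀ {i j} (p : i I.≼ j) x → (j , S.transport p ⟨$⟩ x) LimI.≈ (i , x)
  transport-≈-lim {j = j} p x = j , I.≼-refl , p , S.transport-id I.≼-refl (S.transport p ⟨$⟩ x)

  Lim-inclusion-surjective : Surjective LimJ._≈_ LimI._≈_ (Lim-inclusion ⟨$⟩_)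
  Lim-inclusion-surjective (i , x) =
    (cof ⟨$⟩ i , S.transport (cof-upper i) ⟨$⟩ x) ,
    -- `Surjective` asks that every `z` equal to the chosen preimage is also sent to `(i , x)`,
    -- hence the appeal to congruence.
    λ z≈ → LimI.trans (Func.cong Lim-inclusion z≈) (transport-≈-lim (cof-upper i) x)

  Lim-bijection : Bijection (Lim-set SJ) (Lim-set S)
  Lim-bijection = record
    { to        = Lim-inclusion ⟨$⟩_
    ; cong      = Func.cong Lim-inclusion
    ; bijective = Lim-inclusion-injective , Lim-inclusion-surjective
    }

  restrict : CompatibleFunctions S → CompatibleFunctions SJ
  restrict T = record
    { Θ          = λ j → Θ (e ⟨$⟩ j)
    ; Θ∈F        = λ j → Θ∈F (e ⟨$⟩ j)
    -- The order and transports over `J` are by definition those between images under `e`.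
    ; compatible = compatible
    }
    where open CompatibleFunctions T

  extend : CompatibleFunctions SJ → CompatibleFunctions S
  extend T = record
    { Θ          = λ i → Θ (cof ⟨$⟩ i) ∘ₛ S.transport (cof-upper i)
    ; Θ∈F        = λ i → S.transport-morphism (cof-upper i) (Θ (cof ⟨$⟩ i)) (Θ∈F (cof ⟨$⟩ i))
    ; compatible = λ {i} {i′} p x →
        let j  = cof ⟨$⟩ i
            j′ = cof ⟨$⟩ i′
            u  = cof-upper i
            u′ = cof-upper i′
            v  = cof-mono p
            -- The routes from `i` to `e (cof i′)` through `e (cof i)` and through `i′` both have
            -- `transport r` as composite.
            r  = I.≼-trans u v
        in begin
          Θ j ⟨$⟩ (S.transport u ⟨$⟩ x)
            ≈⟨ compatible v (S.transport u ⟨$⟩ x) ⟩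
          Θ j′ ⟨$⟩ (S.transport v ⟨$⟩ (S.transport u ⟨$⟩ x))
            ≈⟨ Func.cong (Θ j′) (S.transport-∘ u v r x) ⟨
          Θ j′ ⟨$⟩ (S.transport r ⟨$⟩ x)
            ≈⟨ Func.cong (Θ j′) (S.transport-∘ p u′ r x) ⟩
          Θ j′ ⟨$⟩ (S.transport u′ ⟨$⟩ (S.transport p ⟨$⟩ x)) ∎
    }
    where
    open CompatibleFunctions T
    open SetoidReasoning ℝ-setoid

  Lim-cofinal : Lim SJ ≃ Lim S
  Lim-cofinal = record
    { bijection        = Lim-bijection
    ; morphism         = ⋁-morphism (BishopSpace.topology (Lim SJ)) Lim-inclusion
        λ k (T , k≗T) → base (restrict T , λ x → k≗T (Lim-inclusion ⟨$⟩ x))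
    -- The inverse computes to the preimage chosen in `Lim-inclusion-surjective`, so `eql₀f T`
    -- composed with it agrees definitionally with `eql₀f (extend T)` at each point.
    ; inverse-morphism = ⋁-morphism (BishopSpace.topology (Lim S)) (inverse Lim-bijection)
        λ k (T , k≗T) → base (extend T , λ x → k≗T (inverse Lim-bijection ⟨$⟩ x))
    }

theorem9p12 : ∀ {a ℓ₁ ℓ₂ c ℓ f b ℓ₃}
    (I : DirectedSet a ℓ₁ ℓ₂)
    (S : DirectSpectrum I c ℓ f)
    (C : CofinalSubset I b ℓ₃) →
    Lim (relativeSpectrum S C) ≃ Lim S
theorem9p12 I S C = Lim-cofinal S C
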